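{- For integers $n,d\ge 0$ let $c_{n,d}$ denote the number of $d$-dimensional cubes in the configuration space $\mathcal{S}_{2,n}$ of the robotic arm of length $n$ in a tunnel of width $2$. Then, as formal power series, $$\sum_{n,d\ge 0} c_{n,d}\,x^n y^d=\frac{1+xy+x^2+x^2y+x^3+3x^3y+x^3y^2+2x^4y+2x^4y^2+x^5y^2}{1-2x+x^2-x^3-x^4-2x^4y-2x^5y-x^5y^2-x^6y^2}.$$
   Context: **Positions.** A position of the robotic arm of length $n$ in a tunnel of width $2$ is a lattice path of $n$ unit links starting at $(0,0)$, each link facing up ($u$), down ($d$) or right ($r$), staying in the strip $0\le y\le 2$ and not intersecting itself; equivalently a word in $\{u,d,r\}^n$ with no two consecutive letters $ud$ or $du$ and all heights in $[0,2]$. For $n=0$ there is exactly one (empty) position. **Moves.** (Switch corners) two consecutive links facing different directions (one vertical, one horizontal) interchange directions; (flip the end) the last link rotates by $90^\circ$ ($r\leftrightarrow u$ or $r\leftrightarrow d$). A move is legal only if its result is a position. **Configuration space.** $\mathcal{S}_{2,n}$ is the cubical complex whose vertices are the positions, whose edges are the legal moves, and whose $k$-cubes correspond to $k$-tuples of commutative moves: given $k$ moves applicable at a position $p$, acting on pairwise disjoint sets of links and such that performing any subset of them yields a position, the $2^k$ positions obtained from $p$ by performing the subsets of these moves are the vertices of a $k$-cube (a cube is determined by its set of vertices). -}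

module Defs where

open import Algebra.Properties.Monoid.Sum using (sum⁺-syntax)
open import Data.Bool.Base using (if_then_else_; _∧_)
open import Data.Fin.Base using (Fin; suc; inject₁; fromℕ; toℕ)
open import Data.Fin.Subset using (Subset; inside; outside; ⁅_⁆; _∪_; _∩_; Empty)
open import Data.Integer.Base using (ℤ; +_; -_; 0ℤ; 1ℤ; -1ℤ; _+_; _*_; _≤_)
open import Data.Integer.Properties using (+-0-monoid)
open import Data.Nat.Base using (ℕ; _∸_; _≡ᵇ_)
  renaming (suc to 1+)
open import Data.Product.Base using (_×_; _,_; ∃-syntax)
open import Data.Vec.Base using (Vec; []; _∷_; lookup; _[_]≔_)
open import Data.Vec.Relation.Unary.All using (All)
open import Data.Vec.Relation.Unary.AllPairs using (AllPairs)
open import Data.Vec.Relation.Unary.Unique.Propositional using (Unique)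
open import Function.Bundles using (Bijection)
open import Level using (0ℓ)
open import Relation.Binary.Bundles using (Setoid)
import Relation.Binary.Construct.On as On
open import Relation.Binary.PropositionalEquality using (_≡_; _≢_; refl; setoid)
open import Relation.Unary using (Pred)
open import Relation.Unary.Relation.Binary.Equality using (≐-setoid)

------------------------------------------------------------------------
-- Positions

data Link : Set where
  u d r : Link

Word : ℕ → Set
Word = Vec Link

Point : Set
Point = ℤ × ℤ

origin : Point
origin = 0ℤ , 0ℤ

step : Link → Point → Point
step u (x , y) = x , y + 1ℤ
step d (x , y) = x , y + -1ℤ
step r (x , y) = x + 1ℤ , y

pathFrom : ∀ {n} → Point → Word n → Vec Point (1+ n)
pathFrom P []      = P ∷ []
pathFrom P (ℓ ∷ w) = P ∷ pathFrom (step ℓ P) w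

InTunnel : Pred Point 0ℓ
InTunnel (_ , y) = 0ℤ ≤ y × y ≤ + 2

-- Unit links between lattice points can only meet at lattice points, so the
-- path is free of self-intersections exactly when its vertices are distinct.
IsPosition : ∀ {n} → Pred (Word n) 0ℓ
IsPosition w = All InTunnel (pathFrom origin w) × Unique (pathFrom origin w)

------------------------------------------------------------------------
-- Moves

data Axis : Set where
  horizontal vertical : Axis

axis : Link → Axis
axis u = vertical
axis d = vertical
axis r = horizontal

_⊥_ : Link → Link → Set
a ⊥ b = axis a ≢ axis b

-- `switch i` acts on the consecutive links `inject₁ i` and `suc i`;
-- `flip ℓ` rotates the last link into the direction ℓ.
data Move : ℕ → Set where
  switch : ∀ {n} → Fin n → Move (1+ n)
  flip   : ∀ {n} → Link → Move (1+ n)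

apply : ∀ {n} → Move n → Word n → Word n
apply (switch i) w =
  w [ inject₁ i ]≔ lookup w (suc i) [ suc i ]≔ lookup w (inject₁ i)
apply (flip {n} ℓ) w = w [ fromℕ n ]≔ ℓ

Turns : ∀ {n} → Move n → Pred (Word n) 0ℓ
Turns (switch i)   w = lookup w (inject₁ i) ⊥ lookup w (suc i)
Turns (flip {n} ℓ) w = lookup w (fromℕ n) ⊥ ℓ

Legal : ∀ {n} → Word n → Pred (Move n) 0ℓ
Legal w m = Turns m w × IsPosition (apply m w)

links : ∀ {n} → Move n → Subset n
links (switch i)   = ⁅ inject₁ i ⁆ ∪ ⁅ suc i ⁆
links (flip {n} _) = ⁅ fromℕ n ⁆

Disjoint : ∀ {n} → Move n → Move n → Set
Disjoint m m′ = Empty (links m ∩ links m′)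

------------------------------------------------------------------------
-- Cubes of the configuration space

perform : ∀ {n k} → Subset k → Vec (Move n) k → Word n → Word n
perform []            []       w = w
perform (inside  ∷ S) (m ∷ ms) w = perform S ms (apply m w)
perform (outside ∷ S) (_ ∷ ms) w = perform S ms w

record Cube (n k : ℕ) : Set where
  field
    base       : Word n
    moves      : Vec (Move n) k
    isPosition : IsPosition base
    legal      : All (Legal base) moves
    disjoint   : AllPairs Disjoint moves
    commuting  : ∀ (S : Subset k) → IsPosition (perform S moves base)

  vertices : Pred (Word n) 0ℓ
  vertices w = ∃[ S ] perform S moves base ≡ w

-- A cube is determined by its set of vertices: neither the choice of base
-- vertex nor the order of the moves matters.
cubes : ℕ → ℕ → Setoid 0ℓ 0ℓ
cubes n k = On.setoid (≐-setoid (Word n) 0ℓ) (Cube.vertices {n} {k})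

HasCardinality : Setoid 0ℓ 0ℓ → ℕ → Set
HasCardinality A c = Bijection (setoid (Fin c)) A

------------------------------------------------------------------------
-- Formal power series in x and y over ℤ; `f n k` is the coefficient of xⁿyᵏ.

Series : Set
Series = ℕ → ℕ → ℤ

infix  4 _≈_ _≈_/_
infixl 6 _⊕_
infixl 7 _⊛_
infix  8 _·x^_y^_

_≈_ : Series → Series → Set
f ≈ g = ∀ n k → f n k ≡ g n k

_⊕_ : Series → Series → Series
(f ⊕ g) n k = f n k + g n k

∑≤ : ∀ n → (Fin (1+ n) → ℤ) → ℤ
∑≤ = sum⁺-syntax +-0-monoid

_⊛_ : Series → Series → Series
(f ⊛ g) n k =
  ∑≤ n λ i → ∑≤ k λ j → f (toℕ i) (toℕ j) * g (n ∸ toℕ i) (k ∸ toℕ j)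

_·x^_y^_ : ℤ → ℕ → ℕ → Series
(a ·x^ i y^ j) n k = if (n ≡ᵇ i) ∧ (k ≡ᵇ j) then a else 0ℤ

-- f = p / q in ℤ[[x,y]], meaningful when q is invertible there, i.e. when its
-- constant coefficient is ±1.
_≈_/_ : Series → Series → Series → Set
f ≈ p / q = f ⊛ q ≈ p

numerator : Series
numerator =
    (+ 1) ·x^ 0 y^ 0
  ⊕ (+ 1) ·x^ 1 y^ 1
  ⊕ (+ 1) ·x^ 2 y^ 0
  ⊕ (+ 1) ·x^ 2 y^ 1
  ⊕ (+ 1) ·x^ 3 y^ 0
  ⊕ (+ 3) ·x^ 3 y^ 1
  ⊕ (+ 1) ·x^ 3 y^ 2
  ⊕ (+ 2) ·x^ 4 y^ 1
  ⊕ (+ 2) ·x^ 4 y^ 2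
  ⊕ (+ 1) ·x^ 5 y^ 2

denominator : Series
denominator =
    (+ 1)   ·x^ 0 y^ 0
  ⊕ (- + 2) ·x^ 1 y^ 0
  ⊕ (+ 1)   ·x^ 2 y^ 0
  ⊕ (- + 1) ·x^ 3 y^ 0
  ⊕ (- + 1) ·x^ 4 y^ 0
  ⊕ (- + 2) ·x^ 4 y^ 1
  ⊕ (- + 2) ·x^ 5 y^ 1
  ⊕ (- + 1) ·x^ 5 y^ 2
  ⊕ (- + 1) ·x^ 6 y^ 2

denominator-constant : denominator 0 0 ≡ 1ℤ
denominator-constant = refl

generatingFunction : (ℕ → ℕ → ℕ) → Series
generatingFunction c n k = + c n k

{-# OPTIONS --safe #-}
-- A cube is read off link by link: a link untouched by its moves is fixed, a
-- switched corner is a block of two links {r v, v r}, and a flipped end is a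
-- last link {r, v}, with v vertical. Since switching a corner does not move its
-- endpoints, a cube is a word in these blocks accepted by a finite automaton
-- that remembers the height and the last link, where a corner counts as ending
-- in its vertical link (the more restrictive of its two endings). Up to
-- reflection of the tunnel the automaton has four states; with z = x + x²y for
-- the weight of a vertical link or corner, their series satisfy
--   W = 1 + xy + x W + z L      L = 1 + xy + x C + z E
--   C = 1 + 2xy + x C + 2z E    E = 1 + x W
-- and W, whose state (at a wall, after a horizontal link) is also the initial
-- one, is the series of all cubes.
module Submission where

open import Defs
open import Algebra.Properties.CommutativeMonoid.Sum using (∑-distrib-+)
open import Data.Bool.Base using (Bool; true; false; not; if_then_else_; _∧_)
open import Data.Bool.Properties using (not-involutive)
open import Data.Fin.Base using (Fin; zero; suc; toℕ)
open import Data.Fin.Properties using (+↔⊎; *↔×)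
open import Data.Fin.Subset using (Subset; inside; outside; _∈_; _∪_)
  renaming (⊥ to ∅)
open import Data.Fin.Subset.Properties
  using (x∈p∩q⁻; ∉⊥; drop-∷-Empty; ∪-identityˡ)
open import Data.Integer.Base as ℤ
  using (ℤ; +_; -_; 0ℤ; 1ℤ; -1ℤ; _+_; _*_; +≤+; -<+; +<+)
open import Data.Integer.Properties
  using (*-distribˡ-+; *-identityʳ; *-zeroʳ; *-comm; +-identityʳ; +-identityˡ; +-assoc;
         pos-+; pos-*; +-monoʳ-<; <-trans; <-irrefl; +-0-monoid; +-0-commutativeMonoid)
open import Algebra.Properties.Monoid.Sum +-0-monoid using (sum-cong-≗; sum-replicate-zero)
open import Data.Integer.Tactic.RingSolver using (solve; solve-∀)
import Data.List.Base as List
open import Data.Nat.Base as ℕ using (ℕ; zero; suc; _∸_; _≡ᵇ_; z≤n; s≤s)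
open import Data.Product.Base using (Σ-syntax; ∃-syntax; _×_; _,_; proj₁; proj₂)
open import Data.Product.Function.Dependent.Propositional using (congˡ)
open import Data.Sum.Base using (_⊎_; inj₁; inj₂; [_,_]′)
open import Data.Sum.Function.Propositional using (_⊎-↔_)
open import Data.Vec.Base using (Vec; []; _∷_; map; here; there)
open import Data.Vec.Properties using (map-∘; ∷-injectiveˡ; ∷-injectiveʳ)
open import Data.Vec.Relation.Unary.All as All using (All; []; _∷_)
import Data.Vec.Relation.Unary.All.Properties as All
open import Data.Vec.Relation.Unary.AllPairs as AllPairs using (AllPairs; []; _∷_)
import Data.Vec.Relation.Unary.AllPairs.Properties as AllPairs
open import Data.Vec.Relation.Unary.Unique.Propositional using (Unique)
open import Function.Base using (_∘_)
open import Function.Bundles using (Inverse; _↔_; mk↔ₛ′)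
open import Function.Properties.Inverse using (↔-sym; ↔-trans)
open import Level using (0ℓ)
open import Relation.Binary.PropositionalEquality
  using (_≡_; _≢_; refl; sym; trans; cong; cong₂; subst; module ≡-Reasoning)
open import Relation.Nullary using (¬_; contradiction)
open import Relation.Unary using (Pred; _⊆_; _≐_)
open import Relation.Unary.Properties using (≐-refl; ≐-sym; ≐-trans)

-- Classes of automaton states and the count of cubes

-- The states W, C, L, E above: at height 0 or 2, resp. 1, after a horizontal
-- link; at height 1, resp. 0 or 2, after a vertical one.
data Class : Set where
  wall centre leaving landing : Class

rest climb : Class → Class
rest wall    = wall
rest centre  = centre
rest leaving = centre
rest landing = wall

climb wall    = leaving
climb centre  = landing
climb leaving = landing
climb landing = leaving

-- The number of vertical directions available. As `landing` has none, the
-- value `climb landing` is junk; it is chosen to make `climb-rest` hold.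
exits : Class → ℕ
exits wall    = 1
exits centre  = 2
exits leaving = 1
exits landing = 0

-- `through s` counts the continuations that begin with a vertical link, a corner
-- or a flipped end leading to s, the length being that beyond the first link.
count through : Class → ℕ → ℕ → ℕ
count s zero    zero    = 1
count s zero    (suc k) = 0
count s (suc n) k       = count (rest s) n k ℕ.+ exits s ℕ.* through (climb s) n k

through s n       zero    = count s n zero
through s zero    (suc k) = count s zero k
through s (suc n) (suc k) = count s (suc n) (suc k) ℕ.+ count s n k

-- Directions, and states up to reflection

data Vert : Set where
  up down : Vert

⌊_⌋ : Vert → Link
⌊ up ⌋   = u
⌊ down ⌋ = d

opposite : Vert → Vert
opposite up   = down
opposite down = up

⌊⌋-injective : ∀ {x y} → ⌊ x ⌋ ≡ ⌊ y ⌋ → x ≡ y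
⌊⌋-injective {up}   {up}   _ = refl
⌊⌋-injective {down} {down} _ = refl

r≢⌊⌋ : ∀ {x} → r ≢ ⌊ x ⌋
r≢⌊⌋ {up}   ()
r≢⌊⌋ {down} ()

-- A reflected state is a class with a direction: the direction pointing away
-- from the wall for `wall`, that of the last link for `leaving` and `landing`,
-- and without meaning for `centre`.
restDir : Class → Vert → Vert
restDir wall    v = v
restDir centre  v = v
restDir leaving v = v
restDir landing v = opposite v

turn : ∀ s → Fin (exits s) → Vert → Vert
turn wall    zero       v = v
turn centre  zero       v = v
turn centre  (suc zero) v = opposite v
turn leaving zero       v = v

v≢opposite : ∀ {v} → v ≢ opposite v
v≢opposite {up}   ()
v≢opposite {down} ()

turn-injective : ∀ s v {e e′} → turn s e v ≡ turn s e′ v → e ≡ e′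
turn-injective wall    v {zero}     {zero}     _  = refl
turn-injective centre  v {zero}     {zero}     _  = refl
turn-injective centre  v {zero}     {suc zero} eq = contradiction eq v≢opposite
turn-injective centre  v {suc zero} {zero}     eq = contradiction (sym eq) v≢opposite
turn-injective centre  v {suc zero} {suc zero} _  = refl
turn-injective leaving v {zero}     {zero}     _  = refl

-- Normal forms of cubes

data Code (s : Class) (v : Vert) : ℕ → ℕ → Set
data Through (s : Class) (v : Vert) : ℕ → ℕ → Set

data Code s v where
  []       : Code s v zero zero
  right    : ∀ {n k} → Code (rest s) (restDir s v) n k → Code s v (suc n) k
  vertical : ∀ {n k} (e : Fin (exits s)) →
             Through (climb s) (turn s e v) n k → Code s v (suc n) k

-- The state is the one after the vertical link, and the length `n` leaves out the first link: hence
-- `corner` adds one to it, and it is zero for `tip`.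
data Through s v where
  link   : ∀ {n k} → Code s v n k → Through s v n k
  corner : ∀ {n k} → Code s v n k → Through s v (suc n) (suc k)
  tip    : Through s v zero (suc zero)

-- Counting codes

code↔⊎ : ∀ {s v n k} → Code s v (suc n) k ↔
  (Code (rest s) (restDir s v) n k ⊎
   (Σ[ e ∈ Fin (exits s) ] Through (climb s) (turn s e v) n k))
code↔⊎ = mk↔ₛ′
  (λ { (right C) → inj₁ C ; (vertical e T) → inj₂ (e , T) })
  (λ { (inj₁ C) → right C ; (inj₂ (e , T)) → vertical e T })
  (λ { (inj₁ C) → refl ; (inj₂ (e , T)) → refl })
  (λ { (right C) → refl ; (vertical e T) → refl })

through↔⊎ : ∀ {s v n k} → Through s v (suc n) (suc k) ↔
  (Code s v (suc n) (suc k) ⊎ Code s v n k)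
through↔⊎ = mk↔ₛ′
  (λ { (link C) → inj₁ C ; (corner C) → inj₂ C })
  (λ { (inj₁ C) → link C ; (inj₂ C) → corner C })
  (λ { (inj₁ C) → refl ; (inj₂ C) → refl })
  (λ { (link C) → refl ; (corner C) → refl })

-- Both bijections follow the recursion of `count` and `through` clause by clause: sums become
-- disjoint unions and products become pairs.
code↔ : ∀ s v n k → Fin (count s n k) ↔ Code s v n k
through↔ : ∀ s v n k → Fin (through s n k) ↔ Through s v n k

code↔ s v zero zero = mk↔ₛ′ (λ _ → []) (λ _ → zero) (λ { [] → refl }) (λ { zero → refl })
code↔ s v zero (suc k) = mk↔ₛ′ (λ ()) (λ ()) (λ ()) (λ ())
code↔ s v (suc n) k = ↔-trans +↔⊎ (↔-trans
  (code↔ (rest s) (restDir s v) n k ⊎-↔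
    ↔-trans *↔× (congˡ λ {e} → through↔ (climb s) (turn s e v) n k))
  (↔-sym code↔⊎))

through↔ s v n zero = ↔-trans (code↔ s v n zero)
  (mk↔ₛ′ link (λ { (link C) → C }) (λ { (link C) → refl }) (λ _ → refl))
through↔ s v zero (suc zero) = mk↔ₛ′
  (λ _ → tip) (λ _ → zero) (λ { tip → refl ; (link ()) }) (λ { zero → refl })
-- Both sides are empty: `tip` carries a single move, and `link` would leave moves to an empty word.
through↔ s v zero (suc (suc k)) = mk↔ₛ′ (λ ()) (λ { (link ()) }) (λ { (link ()) }) (λ ())
through↔ s v (suc n) (suc k) = ↔-trans +↔⊎ (↔-trans
  (code↔ s v (suc n) (suc k) ⊎-↔ code↔ s v n k) (↔-sym through↔⊎))

-- The words of a code

word  : ∀ {s v n k} → Code s v n k → Subset k → Word n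
wordᵗ : ∀ {s v n k} → Through s v n k → Subset k → Word (suc n)

word []             _ = []
word (right C)      S = r ∷ word C S
word (vertical e T) S = wordᵗ T S

wordᵗ {v = v} (link C)   S             = ⌊ v ⌋ ∷ word C S
-- Unmoved means horizontal, so in `word C ∅` every corner has its horizontal link first and a
-- flipped end is horizontal.
wordᵗ {v = v} (corner C) (outside ∷ S) = r ∷ ⌊ v ⌋ ∷ word C S
wordᵗ {v = v} (corner C) (inside  ∷ S) = ⌊ v ⌋ ∷ r ∷ word C S
wordᵗ         tip        (outside ∷ S) = r ∷ []
wordᵗ {v = v} tip        (inside  ∷ S) = ⌊ v ⌋ ∷ []

-- Positions

-- The letter is tied to the exit by an equation, because unification would get stuck on a call of
-- `turn` in the index.
data Accepted : Class → Vert → ∀ {n} → Word n → Set where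
  []       : ∀ {s v} → Accepted s v []
  right    : ∀ {s v n} {w : Word n} → Accepted (rest s) (restDir s v) w → Accepted s v (r ∷ w)
  vertical : ∀ {s v ℓ n} {w : Word n} (e : Fin (exits s)) → ℓ ≡ ⌊ turn s e v ⌋ →
             Accepted (climb s) (turn s e v) w → Accepted s v (ℓ ∷ w)

-- A vertical link forbids turning back and a horizontal one lifts this, so resting only adds
-- continuations.
relax : ∀ s {v n} {w : Word n} → Accepted s v w → Accepted (rest s) (restDir s v) w
relax wall    a                    = a
relax centre  a                    = a
relax leaving []                   = []
relax leaving (right a)            = right a
relax leaving (vertical zero eq a) = vertical zero eq a
relax landing []                   = []
relax landing (right a)            = right a

-- Resting first neither changes the height nor closes an exit, so the horizontal-first order of a
-- corner reaches the same state as its vertical link alone.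
delay : ∀ s e {v n} {w : Word n} →
  Accepted (climb s) (turn s e v) w → Accepted s v (r ∷ ⌊ turn s e v ⌋ ∷ w)
delay wall    zero       a = right (vertical zero refl a)
delay centre  zero       a = right (vertical zero refl a)
delay centre  (suc zero) a = right (vertical (suc zero) refl a)
delay leaving zero       a = right (vertical zero refl a)

word-accepted : ∀ {s v n k} (C : Code s v n k) S → Accepted s v (word C S)
word-accepted     []                      S             = []
word-accepted     (right C)               S             = right (word-accepted C S)
word-accepted     (vertical e (link C))   S             = vertical e refl (word-accepted C S)
word-accepted {s} (vertical e (corner C)) (outside ∷ S) = delay s e (word-accepted C S)
-- In this order the corner ends horizontally, in a more permissive state than the one recorded in
-- the code.
word-accepted {s} (vertical e (corner C)) (inside  ∷ S) =
  vertical e refl (right (relax (climb s) (word-accepted C S)))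
word-accepted     (vertical e tip)        (outside ∷ S) = right []
word-accepted     (vertical e tip)        (inside  ∷ S) = vertical e refl []

right⁻ : ∀ {s v n} {w : Word n} → Accepted s v (r ∷ w) → Accepted (rest s) (restDir s v) w
right⁻ (right a)         = a
right⁻ (vertical e eq a) = contradiction eq r≢⌊⌋

vertical⁻ : ∀ {s v x n ℓ} {w : Word n} → ℓ ≡ ⌊ x ⌋ → Accepted s v (ℓ ∷ w) →
  (∃[ e ] turn s e v ≡ x) × Accepted (climb s) x w
vertical⁻ ℓ≡x (right a) = contradiction ℓ≡x r≢⌊⌋
vertical⁻ ℓ≡x (vertical e refl a) =
  (e , ⌊⌋-injective ℓ≡x) , subst (λ x → Accepted _ x _) (⌊⌋-injective ℓ≡x) a

climb-rest : ∀ s → climb (rest s) ≡ climb s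
climb-rest wall    = refl
climb-rest centre  = refl
climb-rest leaving = refl
climb-rest landing = refl

-- This order ends in the vertical link and so imposes on the rest the state that a corner records.
right-vertical⁻ : ∀ {s v x n} {w : Word n} → 
  Accepted s v (r ∷ ⌊ x ⌋ ∷ w) → Accepted (climb s) x w
right-vertical⁻ {s} a =
  subst (λ t → Accepted t _ _) (climb-rest s) (proj₂ (vertical⁻ refl (right⁻ a)))

-- Accepted words stay in the tunnel

height : Class → Vert → ℤ
height wall    up   = + 0
height wall    down = + 2
height centre  _    = + 1
height leaving _    = + 1
height landing up   = + 2
height landing down = + 0

height-inTunnel : ∀ s v → 0ℤ ℤ.≤ height s v × height s v ℤ.≤ + 2
height-inTunnel wall    up   = +≤+ z≤n , +≤+ z≤n
height-inTunnel wall    down = +≤+ z≤n , +≤+ (s≤s (s≤s z≤n))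
height-inTunnel centre  _    = +≤+ z≤n , +≤+ (s≤s z≤n)
height-inTunnel leaving _    = +≤+ z≤n , +≤+ (s≤s z≤n)
height-inTunnel landing up   = +≤+ z≤n , +≤+ (s≤s (s≤s z≤n))
height-inTunnel landing down = +≤+ z≤n , +≤+ z≤n

height-rest : ∀ s v → height s v ≡ height (rest s) (restDir s v)
height-rest wall    v    = refl
height-rest centre  v    = refl
height-rest leaving v    = refl
height-rest landing up   = refl
height-rest landing down = refl

height-climb : ∀ s e v x →
  step ⌊ turn s e v ⌋ (x , height s v) ≡ (x , height (climb s) (turn s e v))
height-climb wall    zero       up   x = refl
height-climb wall    zero       down x = refl
height-climb centre  zero       up   x = refl
height-climb centre  zero       down x = refl
height-climb centre  (suc zero) up   x = refl
height-climb centre  (suc zero) down x = refl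
height-climb leaving zero       up   x = refl
height-climb leaving zero       down x = refl

accepted⇒inTunnel : ∀ {s v n} {w : Word n} → Accepted s v w → ∀ x →
  All InTunnel (pathFrom (x , height s v) w)
accepted⇒inTunnel {s} {v} [] x = height-inTunnel s v ∷ []
accepted⇒inTunnel {s} {v} {w = _ ∷ w} (right a) x = height-inTunnel s v ∷
  subst (λ y → All InTunnel (pathFrom (x + 1ℤ , y) w)) (sym (height-rest s v))
    (accepted⇒inTunnel a (x + 1ℤ))
accepted⇒inTunnel {s} {v} {w = _ ∷ w} (vertical e refl a) x = height-inTunnel s v ∷
  subst (λ P → All InTunnel (pathFrom P w)) (sym (height-climb s e v x))
    (accepted⇒inTunnel a x)

-- Accepted words do not intersect themselves

i<i+1 : ∀ i → i ℤ.< i + 1ℤ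
i<i+1 i = subst (ℤ._< i + 1ℤ) (+-identityʳ i) (+-monoʳ-< i (+<+ (s≤s z≤n)))

i-1<i : ∀ i → i + -1ℤ ℤ.< i
i-1<i i = subst (i + -1ℤ ℤ.<_) (+-identityʳ i) (+-monoʳ-< i -<+)

_<[_]_ : ℤ → Vert → ℤ → Set
i <[ up ]   j = i ℤ.< j
i <[ down ] j = j ℤ.< i

East : Point → Pred Point 0ℓ
East P Q = proj₁ P ℤ.< proj₁ Q

-- A later vertex can differ from `P` in two ways: it lies in a later column, or further along the
-- vertical run that leaves `P`.
Beyond : Vert → Point → Pred Point 0ℓ
Beyond v P Q = East P Q ⊎ proj₂ P <[ v ] proj₂ Q

beyond⇒≢ : ∀ v {P Q} → Beyond v P Q → P ≢ Q
beyond⇒≢ _    (inj₁ x<x) refl = <-irrefl refl x<x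
beyond⇒≢ up   (inj₂ y<y) refl = <-irrefl refl y<y
beyond⇒≢ down (inj₂ y<y) refl = <-irrefl refl y<y

step-beyond : ∀ v (P Q : Point) → proj₂ P <[ v ] proj₂ Q → proj₂ P <[ v ] proj₂ (step ⌊ v ⌋ Q)
step-beyond up   P Q y<y = <-trans y<y (i<i+1 (proj₂ Q))
step-beyond down P Q y<y = <-trans (i-1<i (proj₂ Q)) y<y

<[]-step : ∀ v (P : Point) → proj₂ P <[ v ] proj₂ (step ⌊ v ⌋ P)
<[]-step up   P = i<i+1 (proj₂ P)
<[]-step down P = i-1<i (proj₂ P)

east-path : ∀ {n} P Q (w : Word n) → East P Q → All (East P) (pathFrom Q w)
east-path P Q []      x<x = x<x ∷ []
east-path P Q (u ∷ w) x<x = x<x ∷ east-path P (step u Q) w x<x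
east-path P Q (d ∷ w) x<x = x<x ∷ east-path P (step d Q) w x<x
east-path P Q (r ∷ w) x<x = x<x ∷ east-path P (step r Q) w (<-trans x<x (i<i+1 (proj₁ Q)))

mutual
  -- A vertical run moves away from `P` in the direction `v`, and the horizontal link that ends it
  -- puts everything after it east of `P`. The two lemmas follow the states of the run, which can go
  -- no further than `landing`.
  beyond-leaving : ∀ {v n} P Q {w : Word n} → Accepted leaving v w →
    proj₂ P <[ v ] proj₂ Q → proj₁ P ≡ proj₁ Q → All (Beyond v P) (pathFrom Q w)
  beyond-leaving P Q []        y<y _    = inj₂ y<y ∷ []
  beyond-leaving P Q {_ ∷ w} (right a) y<y refl =
    inj₂ y<y ∷ All.map inj₁ (east-path P (step r Q) w (i<i+1 (proj₁ Q)))
  beyond-leaving {up}   P Q (vertical zero refl a) y<y eq =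
    inj₂ y<y ∷ beyond-landing P (step u Q) a (step-beyond up P Q y<y) eq
  beyond-leaving {down} P Q (vertical zero refl a) y<y eq =
    inj₂ y<y ∷ beyond-landing P (step d Q) a (step-beyond down P Q y<y) eq

  beyond-landing : ∀ {v n} P Q {w : Word n} → Accepted landing v w →
    proj₂ P <[ v ] proj₂ Q → proj₁ P ≡ proj₁ Q → All (Beyond v P) (pathFrom Q w)
  beyond-landing P Q []        y<y _    = inj₂ y<y ∷ []
  beyond-landing P Q {_ ∷ w} (right a) y<y refl =
    inj₂ y<y ∷ All.map inj₁ (east-path P (step r Q) w (i<i+1 (proj₁ Q)))

same-column : ∀ v P → proj₁ P ≡ proj₁ (step ⌊ v ⌋ P)
same-column up   P = refl
same-column down P = refl

beyond-climb : ∀ s {v n} P {w : Word n} → Accepted (climb s) v w →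
  All (Beyond v P) (pathFrom (step ⌊ v ⌋ P) w)
beyond-climb wall    {v} P a = beyond-leaving P _ a (<[]-step v P) (same-column v P)
beyond-climb centre  {v} P a = beyond-landing P _ a (<[]-step v P) (same-column v P)
beyond-climb leaving {v} P a = beyond-landing P _ a (<[]-step v P) (same-column v P)
beyond-climb landing {v} P a = beyond-leaving P _ a (<[]-step v P) (same-column v P)

accepted⇒unique : ∀ {s v n} {w : Word n} → Accepted s v w → ∀ P → Unique (pathFrom P w)
accepted⇒unique [] P = [] ∷ []
accepted⇒unique {w = _ ∷ w} (right a) P =
  All.map (λ x<x → λ { refl → <-irrefl refl x<x }) (east-path P (step r P) w (i<i+1 (proj₁ P)))
  ∷ accepted⇒unique a (step r P)
accepted⇒unique {s} {v} (vertical e refl a) P =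
  All.map (beyond⇒≢ (turn s e v)) (beyond-climb s P a) ∷ accepted⇒unique a _

-- Positions are accepted

data Moving : Class → Set where
  leaving : Moving leaving
  landing : Moving landing

rest-still : ∀ s → ¬ Moving (rest s)
rest-still wall    ()
rest-still centre  ()
rest-still leaving ()
rest-still landing ()

step-back : ∀ v P → step ⌊ opposite v ⌋ (step ⌊ v ⌋ P) ≡ P
step-back up   (x , y) = cong (x ,_) (trans (+-assoc y 1ℤ -1ℤ) (+-identityʳ y))
step-back down (x , y) = cong (x ,_) (trans (+-assoc y -1ℤ 1ℤ) (+-identityʳ y))

compare : ∀ x v → x ≡ v ⊎ x ≡ opposite v
compare up   up   = inj₁ refl
compare up   down = inj₂ refl
compare down up   = inj₂ refl
compare down down = inj₁ refl

-- The tunnel excludes a step into a wall and `straight` excludes turning back on a vertical link;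
-- what remains are the exits.
exit : ∀ s v x {X} → InTunnel (step ⌊ x ⌋ (X , height s v)) → (Moving s → x ≢ opposite v) →
  ∃[ e ] turn s e v ≡ x
exit s v x h≤ straight with compare x v
exit wall    v    _ _             _        | inj₁ refl = zero , refl
exit wall    up   _ (() , _)      _        | inj₂ refl
exit wall    down _ (_ , +≤+ (s≤s (s≤s ()))) _ | inj₂ refl
exit centre  v    _ _             _        | inj₁ refl = zero , refl
exit centre  v    _ _             _        | inj₂ refl = suc zero , refl
exit leaving v    _ _             _        | inj₁ refl = zero , refl
exit leaving v    _ _             straight | inj₂ refl = contradiction refl (straight leaving)
exit landing up   _ (_ , +≤+ (s≤s (s≤s ()))) _ | inj₁ refl
exit landing down _ (() , _)      _        | inj₁ refl
exit landing v    _ _             straight | inj₂ refl = contradiction refl (straight landing)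

head-pathFrom : ∀ {n} {P : Pred Point 0ℓ} {Q} (w : Word n) → All P (pathFrom Q w) → P Q
head-pathFrom []      (p ∷ _) = p
head-pathFrom (_ ∷ _) (p ∷ _) = p

mutual
  -- After a vertical link the previous vertex lies one step back against `v`. The last hypothesis
  -- keeps the path off it, which rules out a reversal.
  position⇒accepted : ∀ {n} s v X (w : Word n) →
    let P = X , height s v in
    All InTunnel (pathFrom P w) → Unique (pathFrom P w) →
    (Moving s → All (step ⌊ opposite v ⌋ P ≢_) (pathFrom P w)) →
    Accepted s v w
  position⇒accepted s v X [] _ _ _ = []
  position⇒accepted s v X (r ∷ w) (_ ∷ in-tunnel) (_ ∷ unique) _ = right
    (position⇒accepted (rest s) (restDir s v) (X + 1ℤ) w
      (subst (λ y → All InTunnel (pathFrom (X + 1ℤ , y) w)) (height-rest s v) in-tunnel)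
      (subst (λ y → Unique (pathFrom (X + 1ℤ , y) w)) (height-rest s v) unique)
      (λ moving → contradiction moving (rest-still s)))
  position⇒accepted s v X (u ∷ w) = position⇒accepted-vertical s v X up w
  position⇒accepted s v X (d ∷ w) = position⇒accepted-vertical s v X down w

  position⇒accepted-vertical : ∀ {n} s v X x (w : Word n) →
    let P = X , height s v in
    All InTunnel (pathFrom P (⌊ x ⌋ ∷ w)) → Unique (pathFrom P (⌊ x ⌋ ∷ w)) →
    (Moving s → All (step ⌊ opposite v ⌋ P ≢_) (pathFrom P (⌊ x ⌋ ∷ w))) →
    Accepted s v (⌊ x ⌋ ∷ w)
  position⇒accepted-vertical s v X x w (_ ∷ in-tunnel) (fresh ∷ unique) no-return
    with exit s v x {X} (head-pathFrom w in-tunnel)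
      (λ moving → λ { refl → head-pathFrom w (All.tail (no-return moving)) refl })
  ... | e , refl = vertical e refl (position⇒accepted (climb s) x X w
      (subst (λ P → All InTunnel (pathFrom P w)) (height-climb s e v X) in-tunnel)
      (subst (λ P → Unique (pathFrom P w)) (height-climb s e v X) unique)
      -- `fresh` says that the path does not return to the present vertex, which is one step back
      -- from the next one.
      (λ _ → subst (λ P → All (step ⌊ opposite x ⌋ P ≢_) (pathFrom P w)) (height-climb s e v X)
        (subst (λ P → All (P ≢_) (pathFrom (step ⌊ x ⌋ (X , height s v)) w))
          (sym (step-back x _)) fresh)))

accepted⇒position : ∀ {n} {w : Word n} → Accepted wall up w → IsPosition w
accepted⇒position a = accepted⇒inTunnel a 0ℤ , accepted⇒unique a origin

-- From codes to cubes

-- The same move on an arm with one more link in front: a switch is renumbered, while a flip stays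
-- at the end.
raise : ∀ {n} → Move n → Move (suc n)
raise (switch i) = switch (suc i)
raise (flip ℓ)   = flip ℓ

raise² : ∀ {n} → Move n → Move (suc (suc n))
raise² = raise ∘ raise

apply-raise : ∀ {n} (m : Move n) ℓ w → apply (raise m) (ℓ ∷ w) ≡ ℓ ∷ apply m w
apply-raise (switch i) ℓ w = refl
apply-raise (flip _)   ℓ w = refl

perform-raise : ∀ {n k} S (ms : Vec (Move n) k) ℓ w →
  perform S (map raise ms) (ℓ ∷ w) ≡ ℓ ∷ perform S ms w
perform-raise []            []       ℓ w = refl
perform-raise (outside ∷ S) (m ∷ ms) ℓ w = perform-raise S ms ℓ w
perform-raise (inside  ∷ S) (m ∷ ms) ℓ w =
  trans (cong (perform S (map raise ms)) (apply-raise m ℓ w))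
    (perform-raise S ms ℓ (apply m w))

turns-raise : ∀ {n} (m : Move n) {ℓ w} → Turns m w → Turns (raise m) (ℓ ∷ w)
turns-raise (switch i) t = t
turns-raise (flip _)   t = t

turns-raise⁻ : ∀ {n} (m : Move n) {ℓ w} → Turns (raise m) (ℓ ∷ w) → Turns m w
turns-raise⁻ (switch i) t = t
turns-raise⁻ (flip _)   t = t

links-raise : ∀ {n} (m : Move n) → links (raise m) ≡ outside ∷ links m
links-raise (switch i) = refl
links-raise (flip _)   = refl

disjoint-raise : ∀ {n} {m m′ : Move n} → Disjoint m m′ → Disjoint (raise m) (raise m′)
disjoint-raise {m = m} {m′} disj (x , x∈) rewrite links-raise m | links-raise m′ with x | x∈
... | suc y | there y∈ = disj (y , y∈)

disjoint-raise⁻ : ∀ {n} {m m′ : Move n} → Disjoint (raise m) (raise m′) → Disjoint m m′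
disjoint-raise⁻ {m = m} {m′} disj rewrite links-raise m | links-raise m′ = drop-∷-Empty disj

disjoint-corner : ∀ {n} (m : Move n) → Disjoint (switch zero) (raise² m)
disjoint-corner m (x , x∈) rewrite links-raise (raise m) | links-raise m with x | x∈
... | suc (suc y) | there (there y∈) =
  -- Past the first two links, the link set of `switch zero` computes to `∅ ∪ ∅`.
  ∉⊥ (subst (y ∈_) (∪-identityˡ ∅) (proj₁ (x∈p∩q⁻ (∅ ∪ ∅) (links m) y∈)))

-- The cube of a code

moves  : ∀ {s v n k} → Code s v n k → Vec (Move n) k
movesᵗ : ∀ {s v n k} → Through s v n k → Vec (Move (suc n)) k

moves []             = []
moves (right C)      = map raise (moves C)
moves (vertical e T) = movesᵗ T

movesᵗ         (link C)   = map raise (moves C)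
movesᵗ         (corner C) = switch zero ∷ map raise² (moves C)
movesᵗ {v = v} tip        = flip ⌊ v ⌋ ∷ []

perform-raise² : ∀ {n k} S (ms : Vec (Move n) k) ℓ ℓ′ w →
  perform S (map raise² ms) (ℓ ∷ ℓ′ ∷ w) ≡ ℓ ∷ ℓ′ ∷ perform S ms w
perform-raise² S ms ℓ ℓ′ w rewrite map-∘ raise raise ms =
  trans (perform-raise S (map raise ms) ℓ (ℓ′ ∷ w)) (cong (ℓ ∷_) (perform-raise S ms ℓ′ w))

perform-moves : ∀ {s v n k} (C : Code s v n k) S → perform S (moves C) (word C ∅) ≡ word C S
perform-moves []                      []             = refl
perform-moves (right C)               S              =
  trans (perform-raise S (moves C) r (word C ∅)) (cong (r ∷_) (perform-moves C S))
perform-moves (vertical e (link C))   S              =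
  trans (perform-raise S (moves C) _ (word C ∅)) (cong (_ ∷_) (perform-moves C S))
perform-moves (vertical e (corner C)) (outside ∷ S)  =
  trans (perform-raise² S (moves C) _ _ (word C ∅)) (cong (λ w → _ ∷ _ ∷ w) (perform-moves C S))
perform-moves (vertical e (corner C)) (inside  ∷ S)  =
  trans (perform-raise² S (moves C) _ _ (word C ∅)) (cong (λ w → _ ∷ _ ∷ w) (perform-moves C S))
perform-moves (vertical e tip)        (outside ∷ []) = refl
perform-moves (vertical e tip)        (inside  ∷ []) = refl

r⊥⌊⌋ : ∀ v → r ⊥ ⌊ v ⌋
r⊥⌊⌋ up   ()
r⊥⌊⌋ down ()

moves-turn : ∀ {s v n k} (C : Code s v n k) → All (λ m → Turns m (word C ∅)) (moves C)
moves-turn []                      = []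
moves-turn (right C)               = All.map⁺ (All.map (λ {m} → turns-raise m) (moves-turn C))
moves-turn (vertical e (link C))   = All.map⁺ (All.map (λ {m} → turns-raise m) (moves-turn C))
moves-turn (vertical e (corner C)) = r⊥⌊⌋ _ ∷
  All.map⁺ (All.map (λ {m} → turns-raise (raise m) ∘ turns-raise m) (moves-turn C))
moves-turn (vertical e tip)        = r⊥⌊⌋ _ ∷ []

moves-disjoint : ∀ {s v n k} (C : Code s v n k) → AllPairs Disjoint (moves C)
moves-disjoint []                      = []
moves-disjoint (right C)               =
  AllPairs.map⁺ (AllPairs.map (λ {m m′} → disjoint-raise {m = m} {m′}) (moves-disjoint C))
moves-disjoint (vertical e (link C))   =
  AllPairs.map⁺ (AllPairs.map (λ {m m′} → disjoint-raise {m = m} {m′}) (moves-disjoint C))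
moves-disjoint (vertical e (corner C)) = All.map⁺ (All.universal disjoint-corner (moves C)) ∷
  AllPairs.map⁺ (AllPairs.map
    (λ {m m′} → disjoint-raise {m = raise m} {raise m′} ∘ disjoint-raise {m = m} {m′})
    (moves-disjoint C))
moves-disjoint (vertical e tip)        = [] ∷ []

perform-∅ : ∀ {n k} (ms : Vec (Move n) k) w → perform ∅ ms w ≡ w
perform-∅ []       w = refl
perform-∅ (_ ∷ ms) w = perform-∅ ms w

-- A single move is performed by the subset that contains it alone; this yields the legality of each
-- move of a cube.
apply-satisfies : ∀ {n k} (P : Pred (Word n) 0ℓ) (ms : Vec (Move n) k) w →
  (∀ S → P (perform S ms w)) → All (λ m → P (apply m w)) ms
apply-satisfies P []       w p = []
apply-satisfies P (m ∷ ms) w p =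
  subst P (perform-∅ ms (apply m w)) (p (inside ∷ ∅)) ∷
  apply-satisfies P ms w (λ S → p (outside ∷ S))

cube : ∀ {n k} → Code wall up n k → Cube n k
cube C = record
  { base       = word C ∅
  ; moves      = moves C
  ; isPosition = position ∅
  ; legal      = All.zip (moves-turn C , apply-satisfies IsPosition (moves C) (word C ∅) commuting)
  ; disjoint   = moves-disjoint C
  ; commuting  = commuting
  }
  where
  position : ∀ S → IsPosition (word C S)
  position S = accepted⇒position (word-accepted C S)
  commuting : ∀ S → IsPosition (perform S (moves C) (word C ∅))
  commuting S = subst IsPosition (sym (perform-moves C S)) (position S)

-- Vertex sets as images

Image : ∀ {n k} → (Subset k → Word n) → Pred (Word n) 0ℓ
Image f w = ∃[ S ] f S ≡ w

image-mono : ∀ {n k k′} {f : Subset k → Word n} {g : Subset k′ → Word n} →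
  (∀ S → Image g (f S)) → Image f ⊆ Image g
image-mono h (S , refl) = h S

cube-vertices : ∀ {n k} (C : Code wall up n k) → Cube.vertices (cube C) ≐ Image (word C)
cube-vertices C =
  (λ { (S , refl) → S , sym (perform-moves C S) }) ,
  (λ { (S , refl) → S , perform-moves C S })

tail-⊆ : ∀ {n k k′ ℓ} {f : Subset k → Word n} {g : Subset k′ → Word n} →
  Image (λ S → ℓ ∷ f S) ⊆ Image (λ S → ℓ ∷ g S) → Image f ⊆ Image g
tail-⊆ f⊆g (S , refl) with f⊆g (S , refl)
... | S′ , eq = S′ , ∷-injectiveʳ eq

-- Together with `vertical-start⁻` this recovers the exit from the words: some begin vertically, and
-- all that do begin in the direction `v`.
vertical-start : ∀ {s v n k} (T : Through s v n k) → ∃[ S ] ∃[ w ] wordᵗ T S ≡ ⌊ v ⌋ ∷ w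
vertical-start (link C)   = ∅ , _ , refl
vertical-start (corner C) = inside ∷ ∅ , _ , refl
vertical-start tip        = inside ∷ [] , _ , refl

vertical-start⁻ : ∀ {s v x n k w} (T : Through s v n k) S → wordᵗ T S ≡ ⌊ x ⌋ ∷ w → v ≡ x
vertical-start⁻ (link C)   S             eq = ⌊⌋-injective (∷-injectiveˡ eq)
vertical-start⁻ (corner C) (outside ∷ S) eq = contradiction (∷-injectiveˡ eq) r≢⌊⌋
vertical-start⁻ (corner C) (inside  ∷ S) eq = ⌊⌋-injective (∷-injectiveˡ eq)
vertical-start⁻ tip        (outside ∷ S) eq = contradiction (∷-injectiveˡ eq) r≢⌊⌋
vertical-start⁻ tip        (inside  ∷ S) eq = ⌊⌋-injective (∷-injectiveˡ eq)

-- A code is determined by its set of words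

right⊉vertical : ∀ {s v s′ v′ n k} (C : Code s v n k) (T : Through s′ v′ n k) →
  ¬ Image (wordᵗ T) ⊆ Image (λ S → r ∷ word C S)
right⊉vertical C T T⊆C with vertical-start T
... | S , w , eq with T⊆C (S , eq)
... | _ , eq′ = r≢⌊⌋ (∷-injectiveˡ eq′)

link⊉corner : ∀ {s v n k} (C : Code s v (suc n) (suc k)) (C′ : Code s v n k) →
  ¬ Image (wordᵗ (corner C′)) ⊆ Image (wordᵗ (link C))
link⊉corner C C′ C′⊆C with C′⊆C (outside ∷ ∅ , refl)
... | _ , eq = r≢⌊⌋ (sym (∷-injectiveˡ eq))

corner-⊆ : ∀ {s v n k} (C C′ : Code s v n k) →
  Image (wordᵗ (corner C)) ⊆ Image (wordᵗ (corner C′)) → Image (word C) ⊆ Image (word C′)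
corner-⊆ C C′ C⊆C′ (S , refl) with C⊆C′ (outside ∷ S , refl)
... | outside ∷ S′ , eq = S′ , ∷-injectiveʳ (∷-injectiveʳ eq)
... | inside  ∷ S′ , eq = contradiction (sym (∷-injectiveˡ eq)) r≢⌊⌋

-- First links tell the constructors apart: only `r` for `right`, only vertical for `link`, both for
-- `corner` and `tip`, and the last two differ in length. Then the first block is stripped.
word-injective : ∀ {s v n k} (C C′ : Code s v n k) → Image (word C) ≐ Image (word C′) → C ≡ C′
wordᵗ-injective : ∀ {s v n k} (T T′ : Through s v n k) →
  Image (wordᵗ T) ≐ Image (wordᵗ T′) → T ≡ T′

word-injective []             []               _           = refl
word-injective (right C)      (right C′)       (C⊆C′ , C′⊆C) =
  cong right (word-injective C C′ (tail-⊆ C⊆C′ , tail-⊆ C′⊆C))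
word-injective (right C)      (vertical e T)   (_ , T⊆C)   =
  contradiction (λ {w} → T⊆C {w}) (right⊉vertical C T)
word-injective (vertical e T) (right C)        (T⊆C , _)   =
  contradiction (λ {w} → T⊆C {w}) (right⊉vertical C T)
word-injective {s} {v} (vertical e T) (vertical e′ T′) T≐T′ with vertical-start T
... | S , w , eq with proj₁ T≐T′ (S , eq)
... | S′ , eq′ with turn-injective s v {e′} {e} (vertical-start⁻ T′ S′ eq′)
... | refl = cong (vertical e) (wordᵗ-injective T T′ T≐T′)

wordᵗ-injective (link C)   (link C′)   (C⊆C′ , C′⊆C) =
  cong link (word-injective C C′ (tail-⊆ C⊆C′ , tail-⊆ C′⊆C))
wordᵗ-injective (link C)   (corner C′) (_ , C′⊆C) =
  contradiction (λ {w} → C′⊆C {w}) (link⊉corner C C′)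
wordᵗ-injective (link ())  tip
wordᵗ-injective (corner C) (link C′)   (C⊆C′ , _) =
  contradiction (λ {w} → C⊆C′ {w}) (link⊉corner C′ C)
wordᵗ-injective (corner C) (corner C′) (C⊆C′ , C′⊆C) =
  cong corner (word-injective C C′ (corner-⊆ C C′ C⊆C′ , corner-⊆ C′ C C′⊆C))
wordᵗ-injective tip        (link ())
wordᵗ-injective tip        tip         _ = refl

-- From cubes to codes

-- The order of the moves is free, so `switch zero` may stand anywhere in the list; the others keep
-- their order and lose the first two links.
data Split {n} : ∀ {k} → Vec (Move (suc (suc n))) (suc k) → Vec (Move n) k → Set where
  here  : ∀ {k} (ms : Vec (Move n) k) → Split (switch zero ∷ map raise² ms) ms
  there : ∀ {k m} {ms : Vec _ (suc k)} {ms′} → Split ms ms′ → Split (raise² m ∷ ms) (m ∷ ms′)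

-- The fates of the first link under disjoint moves: fixed, part of a switched corner, or itself the
-- flipped end.
data Peel : ∀ {n k} → Vec (Move (suc n)) k → Set where
  raised : ∀ {n k} (ms : Vec (Move n) k) → Peel (map raise ms)
  corner : ∀ {n k} {ms : Vec (Move (suc (suc n))) (suc k)} {ms′} → Split ms ms′ → Peel ms
  tip    : ∀ ℓ → Peel {zero} (flip ℓ ∷ [])

data First : ∀ {n} → Move (suc n) → Set where
  raised : ∀ {n} (m : Move n) → First (raise m)
  corner : ∀ {n} → First {suc n} (switch zero)
  tip    : ∀ ℓ → First {zero} (flip ℓ)

first : ∀ {n} (m : Move (suc n)) → First m
first         (switch {suc _} zero)    = corner
first         (switch {suc _} (suc i)) = raised (switch i)
first {zero}  (flip ℓ)                 = tip ℓ
first {suc n} (flip ℓ)                 = raised (flip ℓ)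

-- Links are peeled off one at a time; every move that is not raised twice touches one of the first
-- two links.
disjoint-corner⁻ : ∀ {n} (m : Move (suc (suc n))) →
  Disjoint (switch zero) m → ∃[ m′ ] m ≡ raise² m′
disjoint-corner⁻ m disj with first m
... | corner = contradiction (zero , here) disj
... | raised m₁ with first m₁
...   | raised m₂ = m₂ , refl
...   | corner    = contradiction (suc zero , there here) disj
...   | tip _     = contradiction (suc zero , there here) disj

disjoint-from-corner : ∀ {n k} (ms : Vec (Move (suc (suc n))) k) →
  All (Disjoint (switch zero)) ms → ∃[ ms′ ] ms ≡ map raise² ms′
disjoint-from-corner []       []       = [] , refl
disjoint-from-corner (m ∷ ms) (p ∷ ps) with disjoint-corner⁻ m p | disjoint-from-corner ms ps
... | m′ , refl | ms′ , refl = m′ ∷ ms′ , refl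

split-all : ∀ {n k} {P : Pred (Move (suc (suc n))) 0ℓ} {ms : Vec _ (suc k)} {ms′} →
  Split ms ms′ → All P ms → P (switch zero) × All (P ∘ raise²) ms′
split-all (here ms) (p ∷ ps) = p , All.map⁻ ps
split-all (there h) (p ∷ ps) with split-all h ps
... | q , qs = q , p ∷ qs

disjoint-raise²⁻ : ∀ {n} {m m′ : Move n} → Disjoint (raise² m) (raise² m′) → Disjoint m m′
disjoint-raise²⁻ {m = m} {m′} =
  disjoint-raise⁻ {m = m} {m′} ∘ disjoint-raise⁻ {m = raise m} {raise m′}

allPairs-map⁻ : ∀ {A B : Set} {f : A → B} {R : B → B → Set} {n} {xs : Vec A n} →
  AllPairs R (map f xs) → AllPairs (λ x y → R (f x) (f y)) xs
allPairs-map⁻ {xs = []}    []       = []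
allPairs-map⁻ {xs = _ ∷ _} (p ∷ ps) = All.map⁻ p ∷ allPairs-map⁻ ps

split-allPairs : ∀ {n k} {ms : Vec (Move (suc (suc n))) (suc k)} {ms′} →
  Split ms ms′ → AllPairs Disjoint ms → AllPairs Disjoint ms′
split-allPairs (here ms) (_ ∷ ps) =
  AllPairs.map (λ {m m′} → disjoint-raise²⁻ {m = m} {m′}) (allPairs-map⁻ ps)
split-allPairs (there {m = m} h) (p ∷ ps) =
  All.map (λ {m′} → disjoint-raise²⁻ {m = m} {m′}) (proj₂ (split-all h p)) ∷
  split-allPairs h ps

peel : ∀ {n k} (ms : Vec (Move (suc n)) k) → AllPairs Disjoint ms → Peel ms
peel []       []       = raised []
peel (m ∷ ms) (p ∷ ps) with first m
... | corner with disjoint-from-corner ms p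
...   | ms′ , refl = corner (here ms′)
peel (m ∷ ms) (p ∷ ps) | raised m₁ with peel ms ps
-- The case `tip` cannot arise: it would put `m₁` in the empty type `Move zero`.
...   | raised ms′ = raised (m₁ ∷ ms′)
...   | corner h with first m₁ | proj₁ (split-all h p)
...     | raised _ | _    = corner (there h)
...     | corner   | disj = contradiction (suc zero , there here) disj
...     | tip _    | disj = contradiction (suc zero , there here) disj
peel (m ∷ []) (p ∷ ps) | tip ℓ = tip ℓ
peel (m ∷ flip _ ∷ ms) ((p ∷ _) ∷ ps) | tip ℓ = contradiction (zero , here) p

-- `b` decides whether the corner is switched, and `S` which of the other moves are performed.
insert : ∀ {n k} {ms : Vec (Move (suc (suc n))) (suc k)} {ms′} →
  Split ms ms′ → Bool → Subset k → Subset (suc k)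
insert (here _)  b S       = b ∷ S
insert (there h) b (c ∷ S) = c ∷ insert h b S

insert-surjective : ∀ {n k} {ms : Vec (Move (suc (suc n))) (suc k)} {ms′} →
  (h : Split ms ms′) → ∀ S → ∃[ b ] ∃[ S′ ] insert h b S′ ≡ S
insert-surjective (here _)  (b ∷ S) = b , S , refl
insert-surjective (there h) (c ∷ S) with insert-surjective h S
... | b , S′ , refl = b , c ∷ S′ , refl

apply-raise² : ∀ {n} (m : Move n) ℓ ℓ′ w → apply (raise² m) (ℓ ∷ ℓ′ ∷ w) ≡ ℓ ∷ ℓ′ ∷ apply m w
apply-raise² m ℓ ℓ′ w =
  trans (apply-raise (raise m) ℓ (ℓ′ ∷ w)) (cong (ℓ ∷_) (apply-raise m ℓ′ w))

perform-outside : ∀ {n k} {ms : Vec (Move (suc (suc n))) (suc k)} {ms′} →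
  (h : Split ms ms′) → ∀ S ℓ ℓ′ w →
  perform (insert h outside S) ms (ℓ ∷ ℓ′ ∷ w) ≡ ℓ ∷ ℓ′ ∷ perform S ms′ w
perform-outside (here ms) S ℓ ℓ′ w = perform-raise² S ms ℓ ℓ′ w
perform-outside (there h) (outside ∷ S) ℓ ℓ′ w = perform-outside h S ℓ ℓ′ w
perform-outside {ms = _ ∷ ms} (there {m = m} h) (inside ∷ S) ℓ ℓ′ w =
  trans (cong (perform (insert h outside S) ms) (apply-raise² m ℓ ℓ′ w))
    (perform-outside h S ℓ ℓ′ (apply m w))

-- Moves listed before the switch act behind `ℓ ∷ ℓ′` and those listed after it behind `ℓ′ ∷ ℓ`, so
-- its place in the list does not matter.
perform-inside : ∀ {n k} {ms : Vec (Move (suc (suc n))) (suc k)} {ms′} →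
  (h : Split ms ms′) → ∀ S ℓ ℓ′ w →
  perform (insert h inside S) ms (ℓ ∷ ℓ′ ∷ w) ≡ ℓ′ ∷ ℓ ∷ perform S ms′ w
perform-inside (here ms) S ℓ ℓ′ w = perform-raise² S ms ℓ′ ℓ w
perform-inside (there h) (outside ∷ S) ℓ ℓ′ w = perform-inside h S ℓ ℓ′ w
perform-inside {ms = _ ∷ ms} (there {m = m} h) (inside ∷ S) ℓ ℓ′ w =
  trans (cong (perform (insert h inside S) ms) (apply-raise² m ℓ ℓ′ w))
    (perform-inside h S ℓ ℓ′ (apply m w))

turns-raised⁻ : ∀ {n k ℓ} {w : Word n} (ms : Vec (Move n) k) →
  All (λ m → Turns m (ℓ ∷ w)) (map raise ms) → All (λ m → Turns m w) ms
turns-raised⁻ ms = All.map (λ {m} → turns-raise⁻ m) ∘ All.map⁻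

turns-raised²⁻ : ∀ {n k ℓ ℓ′} {w : Word n} {ms : Vec (Move n) k} →
  All (λ m → Turns (raise² m) (ℓ ∷ ℓ′ ∷ w)) ms → All (λ m → Turns m w) ms
turns-raised²⁻ = All.map (λ {m} → turns-raise⁻ m ∘ turns-raise⁻ (raise m))

disjoint-raised⁻ : ∀ {n k} (ms : Vec (Move n) k) →
  AllPairs Disjoint (map raise ms) → AllPairs Disjoint ms
disjoint-raised⁻ ms = AllPairs.map (λ {m m′} → disjoint-raise⁻ {m = m} {m′}) ∘ allPairs-map⁻

perpendicular : ∀ a b → a ⊥ b → (a ≡ r × ∃[ x ] b ≡ ⌊ x ⌋) ⊎ (b ≡ r × ∃[ x ] a ≡ ⌊ x ⌋)
perpendicular r u _   = inj₁ (refl , up , refl)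
perpendicular r d _   = inj₁ (refl , down , refl)
perpendicular u r _   = inj₂ (refl , up , refl)
perpendicular d r _   = inj₂ (refl , down , refl)
perpendicular r r a⊥b = contradiction refl a⊥b
perpendicular u u a⊥b = contradiction refl a⊥b
perpendicular u d a⊥b = contradiction refl a⊥b
perpendicular d u a⊥b = contradiction refl a⊥b
perpendicular d d a⊥b = contradiction refl a⊥b

cons-≐ : ∀ {n k k′ ℓ} {f : Subset k → Word n} {g : Subset k′ → Word n}
  {h : Subset k′ → Word (suc n)} →
  (∀ S → h S ≡ ℓ ∷ g S) → Image f ≐ Image g → Image (λ S → ℓ ∷ f S) ≐ Image h
cons-≐ {ℓ = ℓ} {f} {g} {h} h≡ (f⊆g , g⊆f) = image-mono to , image-mono from
  where
  to : ∀ S → Image h (ℓ ∷ f S)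
  to S with f⊆g (S , refl)
  ... | S′ , eq = S′ , trans (h≡ S′) (cong (ℓ ∷_) eq)
  from : ∀ S → Image (λ S → ℓ ∷ f S) (h S)
  from S with g⊆f (S , refl)
  ... | S′ , eq = S′ , trans (cong (ℓ ∷_) eq) (sym (h≡ S))

code-tip : ∀ {s v x} → Accepted s v (⌊ x ⌋ ∷ []) →
  Σ[ C ∈ Code s v 1 1 ] Image (word C) ≐ (λ w → w ≡ r ∷ [] ⊎ w ≡ ⌊ x ⌋ ∷ [])
code-tip a with proj₁ (vertical⁻ refl a)
... | e , refl = vertical e tip ,
  (λ { (outside ∷ [] , eq) → inj₁ (sym eq) ; (inside ∷ [] , eq) → inj₂ (sym eq) }) ,
  (λ { (inj₁ eq) → outside ∷ [] , sym eq ; (inj₂ eq) → inside ∷ [] , sym eq })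

-- Reading a code off the vertices of a cube

mutual
  -- Blocks are read from left to right, under the invariant that all vertices are accepted from the
  -- current state; `peel` finds the next block.
  code : ∀ {n k} s v (w : Word n) (ms : Vec (Move n) k) →
    All (λ m → Turns m w) ms → AllPairs Disjoint ms → (∀ S → Accepted s v (perform S ms w)) →
    Σ[ C ∈ Code s v n k ] Image (word C) ≐ Image (λ S → perform S ms w)
  code s v [] [] _ _ _ = [] , (λ { (S , refl) → [] , refl }) , (λ { ([] , refl) → [] , refl })
  code s v (ℓ ∷ w) ms turns disj acc with peel ms disj
  code s v (r ∷ w) .(map raise ms) turns disj acc | raised ms
    with code (rest s) (restDir s v) w ms
      (turns-raised⁻ ms turns) (disjoint-raised⁻ ms disj)
      (λ S → right⁻ (subst (Accepted s v) (perform-raise S ms r w) (acc S)))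
  ... | C , eq = right C , cons-≐ (λ S → perform-raise S ms r w) eq
  code s v (u ∷ w) .(map raise ms) turns disj acc | raised ms =
    code-link s v up w ms turns disj acc
  code s v (d ∷ w) .(map raise ms) turns disj acc | raised ms =
    code-link s v down w ms turns disj acc
  code s v (a ∷ b ∷ w) ms turns disj acc | corner {ms′ = ms′} h
    with perpendicular a b (proj₁ (split-all h turns))
  ... | inj₁ (refl , x , refl) =
    let C , C⊆ , C⊇ = code-corner s v x w ms′
          (turns-raised²⁻ (proj₂ (split-all h turns))) (split-allPairs h disj)
          (λ c S → perform (insert h c S) ms (r ∷ ⌊ x ⌋ ∷ w))
          (λ S → perform-outside h S _ _ w) (λ S → perform-inside h S _ _ w)
          (λ c S → acc (insert h c S))
    in C ,
       (λ w∈ → let c , S , eq = C⊆ w∈ in insert h c S , eq) ,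
       image-mono λ S →
         let c , S′ , eq = insert-surjective h S
         in C⊇ (c , S′ , cong (λ S → perform S ms _) eq)
  ... | inj₂ (refl , x , refl) =
    let C , C⊆ , C⊇ = code-corner s v x w ms′
          (turns-raised²⁻ (proj₂ (split-all h turns))) (split-allPairs h disj)
          -- The base has its vertical link first here, so the horizontal-first vertices are those
          -- with the switch performed.
          (λ c S → perform (insert h (not c) S) ms (⌊ x ⌋ ∷ r ∷ w))
          (λ S → perform-inside h S _ _ w) (λ S → perform-outside h S _ _ w)
          (λ c S → acc (insert h (not c) S))
    in C ,
       (λ w∈ → let c , S , eq = C⊆ w∈ in insert h (not c) S , eq) ,
       image-mono λ S →
         let c , S′ , eq = insert-surjective h S
         in C⊇ (not c , S′ ,
              trans (cong (λ c → perform (insert h c S′) ms _) (not-involutive c))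
                (cong (λ S → perform S ms _) eq))
  code s v (a ∷ []) .(flip ℓ ∷ []) (t ∷ []) disj acc | tip ℓ with perpendicular a ℓ t
  -- The exit is read off the vertex with a vertical end: the flipped one here, the base in the
  -- other case.
  ... | inj₁ (refl , x , refl) with code-tip {s} {v} {x} (acc (inside ∷ []))
  ...   | C , C⊆ , C⊇ = C ,
    (λ w∈ → [ (λ eq → outside ∷ [] , sym eq) , (λ eq → inside ∷ [] , sym eq) ]′ (C⊆ w∈)) ,
    λ { (outside ∷ [] , eq) → C⊇ (inj₁ (sym eq)) ; (inside ∷ [] , eq) → C⊇ (inj₂ (sym eq)) }
  code s v (a ∷ []) .(flip ℓ ∷ []) (t ∷ []) disj acc | tip ℓ | inj₂ (refl , x , refl)
    with code-tip {s} {v} {x} (acc (outside ∷ []))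
  ...   | C , C⊆ , C⊇ = C ,
    (λ w∈ → [ (λ eq → inside ∷ [] , sym eq) , (λ eq → outside ∷ [] , sym eq) ]′ (C⊆ w∈)) ,
    λ { (outside ∷ [] , eq) → C⊇ (inj₂ (sym eq)) ; (inside ∷ [] , eq) → C⊇ (inj₁ (sym eq)) }

  code-link : ∀ {n k} s v x (w : Word n) (ms : Vec (Move n) k) →
    All (λ m → Turns m (⌊ x ⌋ ∷ w)) (map raise ms) → AllPairs Disjoint (map raise ms) →
    (∀ S → Accepted s v (perform S (map raise ms) (⌊ x ⌋ ∷ w))) →
    Σ[ C ∈ Code s v (suc n) k ]
      Image (word C) ≐ Image (λ S → perform S (map raise ms) (⌊ x ⌋ ∷ w))
  code-link s v x w ms turns disj acc
    with accepted ← (λ S → vertical⁻ refl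
           (subst (Accepted s v) (perform-raise S ms ⌊ x ⌋ w) (acc S)))
    with (e , refl) , _ ← accepted ∅
    with C , eq ← code (climb s) x w ms (turns-raised⁻ ms turns) (disjoint-raised⁻ ms disj)
           (λ S → proj₂ (accepted S))
    = vertical e (link C) , cons-≐ (λ S → perform-raise S ms ⌊ x ⌋ w) eq

  -- The family `f` hides which order the base has. A vertical-first vertex shows the exit; the
  -- horizontal-first ones, whose corner ends in its vertical link, put the rest in the state
  -- `climb s`.
  code-corner : ∀ {n k} s v x (w : Word n) (ms : Vec (Move n) k) →
    All (λ m → Turns m w) ms → AllPairs Disjoint ms →
    (f : Bool → Subset k → Word (suc (suc n))) →
    (∀ S → f false S ≡ r ∷ ⌊ x ⌋ ∷ perform S ms w) →
    (∀ S → f true  S ≡ ⌊ x ⌋ ∷ r ∷ perform S ms w) →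
    (∀ c S → Accepted s v (f c S)) →
    Σ[ C ∈ Code s v (suc (suc n)) (suc k) ] Image (word C) ≐ (λ w → ∃[ c ] ∃[ S ] f c S ≡ w)
  code-corner s v x w ms turns disj f f₀ f₁ acc
    with proj₁ (vertical⁻ refl (subst (Accepted s v) (f₁ ∅) (acc true ∅)))
  ... | e , refl with code (climb s) x w ms turns disj
      (λ S → right-vertical⁻ (subst (Accepted s v) (f₀ S) (acc false S)))
  ...   | C , C⊆ , C⊇ = vertical e (corner C) , (λ { (S , refl) → to S }) , from
    where
    to : ∀ S → ∃[ c ] ∃[ S′ ] f c S′ ≡ wordᵗ (corner C) S
    to (outside ∷ S) with C⊆ (S , refl)
    ... | S′ , eq = false , S′ , trans (f₀ S′) (cong (λ w → _ ∷ _ ∷ w) eq)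
    to (inside  ∷ S) with C⊆ (S , refl)
    ... | S′ , eq = true , S′ , trans (f₁ S′) (cong (λ w → _ ∷ _ ∷ w) eq)
    from : ∀ {w} → ∃[ c ] ∃[ S′ ] f c S′ ≡ w → Image (wordᵗ (corner C)) w
    from (false , S , refl) with C⊇ (S , refl)
    ... | S′ , eq = outside ∷ S′ , trans (cong (λ w → _ ∷ _ ∷ w) eq) (sym (f₀ S))
    from (true  , S , refl) with C⊇ (S , refl)
    ... | S′ , eq = inside ∷ S′ , trans (cong (λ w → _ ∷ _ ∷ w) eq) (sym (f₁ S))

-- The number of cubes

count-cubes : ∀ n k → HasCardinality (cubes n k) (count wall n k)
count-cubes n k = record
  { to        = λ i → cube (to i)
  ; cong      = λ { refl → ≐-refl }
  ; bijective =
      (λ {i} {j} eq → injective (word-injective (to i) (to j)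
        (≐-trans (≐-sym (cube-vertices (to i))) (≐-trans eq (cube-vertices (to j)))))) ,
      surjective
  }
  where
  codes = code↔ wall up n k
  open Inverse codes using (to; from; strictlyInverseˡ; strictlyInverseʳ)
  injective : ∀ {i j} → to i ≡ to j → i ≡ j
  injective {i} {j} eq =
    trans (sym (strictlyInverseʳ i)) (trans (cong from eq) (strictlyInverseʳ j))
  surjective : ∀ (Q : Cube n k) →
    ∃[ i ] ∀ {j} → j ≡ i → Cube.vertices (cube (to j)) ≐ Cube.vertices Q
  surjective Q with code wall up (Cube.base Q) (Cube.moves Q)
    (All.map proj₁ (Cube.legal Q)) (Cube.disjoint Q)
    (λ S → let in-tunnel , unique = Cube.commuting Q S
           -- The arm starts in the state `wall`, with no vertical link to turn back on.
           in position⇒accepted wall up 0ℤ _ in-tunnel unique λ ())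
  ... | C , C≐Q = from C , λ { refl →
    ≐-trans (cube-vertices (to (from C)))
      (≐-trans
        (subst (λ C′ → Image (word C′) ≐ Image (word C)) (sym (strictlyInverseˡ C)) ≐-refl)
        C≐Q) }

-- The generating function

shift₁ : ℕ → (ℕ → ℤ) → ℕ → ℤ
shift₁ zero    φ n       = φ n
shift₁ (suc i) φ zero    = 0ℤ
shift₁ (suc i) φ (suc n) = shift₁ i φ n

-- Multiplication by x^i y^j, defined by recursion so that it computes.
shift : ℕ → ℕ → Series → Series
shift i j f n k = shift₁ i (λ m → shift₁ j (f m) k) n

F : Class → Series
F s = generatingFunction (count s)

𝟙 : Series
𝟙 = (+ 1) ·x^ 0 y^ 0

-- The summands y, F and xyF come from `tip`, `link` and `corner`.
through-equation : ∀ s n k →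
  + through s n k ≡ shift 0 1 𝟙 n k + F s n k + shift 1 1 (F s) n k
through-equation s zero    zero          = refl
through-equation s (suc n) zero          =
  sym (trans (+-identityʳ _) (+-identityˡ _))
through-equation s zero    (suc zero)    = refl
through-equation s zero    (suc (suc k)) = refl
through-equation s (suc n) (suc k)       =
  trans (pos-+ (count s (suc n) (suc k)) _)
    (cong (_+ F s n k) (sym (+-identityˡ (F s (suc n) (suc k)))))

0+*0≡0 : ∀ i → 0ℤ + i * 0ℤ ≡ 0ℤ
0+*0≡0 i = trans (+-identityˡ _) (*-zeroʳ i)

-- This is F_s = 1 + x F_rest + e x (y + F_climb + xy F_climb) with e = `exits s`, multiplied by x^i
-- y^j because the elimination combines such multiples.
count-equation : ∀ s i j n k →
  shift i j (F s) n k ≡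
    shift i j 𝟙 n k + shift (1 ℕ.+ i) j (F (rest s)) n k +
    + exits s * (shift (1 ℕ.+ i) (1 ℕ.+ j) 𝟙 n k +
                 shift (1 ℕ.+ i) j (F (climb s)) n k +
                 shift (2 ℕ.+ i) (1 ℕ.+ j) (F (climb s)) n k)
count-equation s (suc i) j zero k = sym (0+*0≡0 (+ exits s))
count-equation s (suc i) j (suc n) k = count-equation s i j n k
-- Splitting `n` three ways lets the shifts by up to two in x compute; all terms vanish because the
-- exponent of y is too small.
count-equation s zero (suc j) zero zero = sym (0+*0≡0 (+ exits s))
count-equation s zero (suc j) (suc zero) zero = sym (0+*0≡0 (+ exits s))
count-equation s zero (suc j) (suc (suc n)) zero = sym (0+*0≡0 (+ exits s))
count-equation s zero (suc j) zero (suc k) = count-equation s zero j zero k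
count-equation s zero (suc j) (suc zero) (suc k) = count-equation s zero j (suc zero) k
count-equation s zero (suc j) (suc (suc n)) (suc k) = count-equation s zero j (suc (suc n)) k
count-equation s zero zero zero zero = sym (cong (_+_ 1ℤ) (*-zeroʳ (+ exits s)))
count-equation s zero zero zero (suc k) = sym (0+*0≡0 (+ exits s))
count-equation s zero zero (suc n) k = begin
  + (count (rest s) n k ℕ.+ exits s ℕ.* through (climb s) n k)
    ≡⟨ pos-+ (count (rest s) n k) _ ⟩
  F (rest s) n k + + (exits s ℕ.* through (climb s) n k)
    ≡⟨ cong₂ _+_ (sym (+-identityˡ (F (rest s) n k)))
         (trans (pos-* (exits s) _) (cong (+ exits s *_) (through-equation (climb s) n k))) ⟩
  0ℤ + F (rest s) n k + + exits s *
    (shift 0 1 𝟙 n k + F (climb s) n k + shift 1 1 (F (climb s)) n k) ∎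
  where open ≡-Reasoning

-- Convolution with a monomial

∑-cong : ∀ n {φ ψ : Fin (suc n) → ℤ} → (∀ i → φ i ≡ ψ i) → ∑≤ n φ ≡ ∑≤ n ψ
∑-cong n = sum-cong-≗

∑-+ : ∀ n (φ ψ : Fin (suc n) → ℤ) → ∑≤ n (λ i → φ i + ψ i) ≡ ∑≤ n φ + ∑≤ n ψ
∑-+ n = ∑-distrib-+ +-0-commutativeMonoid

∑-zero : ∀ n → ∑≤ n (λ _ → 0ℤ) ≡ 0ℤ
∑-zero n = sum-replicate-zero (suc n)

⊛-distribˡ-⊕ : ∀ f g h n k → (f ⊛ (g ⊕ h)) n k ≡ (f ⊛ g) n k + (f ⊛ h) n k
⊛-distribˡ-⊕ f g h n k = begin
  ∑≤ n (λ i → ∑≤ k (term (g ⊕ h) i))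
    ≡⟨ ∑-cong n (λ i → trans
         (∑-cong k (λ j → *-distribˡ-+ (f (toℕ i) (toℕ j))
            (g (n ∸ toℕ i) (k ∸ toℕ j)) (h (n ∸ toℕ i) (k ∸ toℕ j))))
         (∑-+ k (term g i) (term h i))) ⟩
  ∑≤ n (λ i → ∑≤ k (term g i) + ∑≤ k (term h i))
    ≡⟨ ∑-+ n (λ i → ∑≤ k (term g i)) (λ i → ∑≤ k (term h i)) ⟩
  ∑≤ n (λ i → ∑≤ k (term g i)) + ∑≤ n (λ i → ∑≤ k (term h i)) ∎
  where
  open ≡-Reasoning
  term : Series → Fin (suc n) → Fin (suc k) → ℤ
  term p i j = f (toℕ i) (toℕ j) * p (n ∸ toℕ i) (k ∸ toℕ j)

∑-if : ∀ n b (φ : Fin (suc n) → ℤ) →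
  ∑≤ n (λ i → if b then φ i else 0ℤ) ≡ (if b then ∑≤ n φ else 0ℤ)
∑-if n true  φ = refl
∑-if n false φ = ∑-zero n

*-if-∧ : ∀ (x a : ℤ) b c →
  x * (if b ∧ c then a else 0ℤ) ≡ (if b then (if c then x * a else 0ℤ) else 0ℤ)
*-if-∧ x a true  true  = refl
*-if-∧ x a true  false = *-zeroʳ x
*-if-∧ x a false c     = *-zeroʳ x

shift₁-unroll : ∀ i φ n →
  (if n ≡ᵇ i then φ 0 else 0ℤ) + shift₁ (suc i) (λ m → φ (suc m)) n ≡ shift₁ i φ n
shift₁-unroll zero    φ zero    = +-identityʳ _
shift₁-unroll zero    φ (suc n) = +-identityˡ _
shift₁-unroll (suc i) φ zero    = refl
shift₁-unroll (suc i) φ (suc n) = shift₁-unroll i φ n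

-- Only the index n - i contributes, and it is in range exactly when i is at most n.
∑-if≡shift₁ : ∀ i φ n →
  ∑≤ n (λ m → if n ∸ toℕ m ≡ᵇ i then φ (toℕ m) else 0ℤ) ≡ shift₁ i φ n
∑-if≡shift₁ zero    φ zero    = +-identityʳ _
∑-if≡shift₁ (suc i) φ zero    = refl
∑-if≡shift₁ zero    φ (suc n) =
  trans (+-identityˡ _) (∑-if≡shift₁ zero (λ m → φ (suc m)) n)
∑-if≡shift₁ (suc i) φ (suc n) = trans
  (cong (_+_ (if n ≡ᵇ i then φ 0 else 0ℤ)) (∑-if≡shift₁ (suc i) (λ m → φ (suc m)) n))
  (shift₁-unroll i φ n)

shift₁-cong : ∀ i {φ ψ : ℕ → ℤ} n → (∀ m → φ m ≡ ψ m) → shift₁ i φ n ≡ shift₁ i ψ n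
shift₁-cong zero    n       φ≡ψ = φ≡ψ n
shift₁-cong (suc i) zero    φ≡ψ = refl
shift₁-cong (suc i) (suc n) φ≡ψ = shift₁-cong i n φ≡ψ

shift₁-*ʳ : ∀ i φ a n → shift₁ i (λ m → φ m * a) n ≡ a * shift₁ i φ n
shift₁-*ʳ zero    φ a n       = *-comm (φ n) a
shift₁-*ʳ (suc i) φ a zero    = sym (*-zeroʳ a)
shift₁-*ʳ (suc i) φ a (suc n) = shift₁-*ʳ i φ a n

⊛-monomial : ∀ f a i j n k → (f ⊛ a ·x^ i y^ j) n k ≡ a * shift i j f n k
⊛-monomial f a i j n k = begin
  ∑≤ n (λ m → ∑≤ k λ l → f (toℕ m) (toℕ l) *
    (if (n ∸ toℕ m ≡ᵇ i) ∧ (k ∸ toℕ l ≡ᵇ j) then a else 0ℤ))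
    ≡⟨ ∑-cong n (λ m → trans
         (∑-cong k λ l →
            *-if-∧ (f (toℕ m) (toℕ l)) a (n ∸ toℕ m ≡ᵇ i) (k ∸ toℕ l ≡ᵇ j))
         (∑-if k (n ∸ toℕ m ≡ᵇ i) (λ l →
            if k ∸ toℕ l ≡ᵇ j then f (toℕ m) (toℕ l) * a else 0ℤ))) ⟩
  ∑≤ n (λ m → if n ∸ toℕ m ≡ᵇ i
    then ∑≤ k (λ l → if k ∸ toℕ l ≡ᵇ j then f (toℕ m) (toℕ l) * a else 0ℤ) else 0ℤ)
    ≡⟨ ∑-if≡shift₁ i (λ m → ∑≤ k (λ l → if k ∸ toℕ l ≡ᵇ j then f m (toℕ l) * a else 0ℤ)) n ⟩
  shift₁ i (λ m → ∑≤ k (λ l → if k ∸ toℕ l ≡ᵇ j then f m (toℕ l) * a else 0ℤ)) n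
    ≡⟨ shift₁-cong i n (λ m → trans (∑-if≡shift₁ j (λ l → f m l * a) k)
         (trans (shift₁-*ʳ j (f m) a k) (*-comm a _))) ⟩
  shift₁ i (λ m → shift₁ j (f m) k * a) n
    ≡⟨ shift₁-*ʳ i (λ m → shift₁ j (f m) k) a n ⟩
  a * shift i j f n k ∎
  where open ≡-Reasoning

monomial≡shift : ∀ a i j n k → (a ·x^ i y^ j) n k ≡ a * shift i j 𝟙 n k
monomial≡shift a zero    zero    zero    zero    = sym (*-identityʳ a)
monomial≡shift a zero    zero    zero    (suc k) = sym (*-zeroʳ a)
monomial≡shift a zero    zero    (suc n) k       = sym (*-zeroʳ a)
monomial≡shift a zero    (suc j) zero    zero    = sym (*-zeroʳ a)
monomial≡shift a zero    (suc j) (suc n) zero    = sym (*-zeroʳ a)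
monomial≡shift a zero    (suc j) zero    (suc k) = monomial≡shift a zero j zero k
monomial≡shift a zero    (suc j) (suc n) (suc k) = monomial≡shift a zero j (suc n) k
monomial≡shift a (suc i) j       zero    k       = sym (*-zeroʳ a)
monomial≡shift a (suc i) j       (suc n) k       = monomial≡shift a i j n k

-- Polynomials acting by shifts, and the elimination

infixl 5 _⊞_
-- Syntax that makes recursion over the monomials possible; `num` and `den` evaluate to `numerator`
-- and `denominator` by computation.
data Poly : Set where
  mono : ℤ → ℕ → ℕ → Poly
  _⊞_ : Poly → Poly → Poly

⟦_⟧ : Poly → Series
⟦ mono a i j ⟧ = a ·x^ i y^ j
⟦ p ⊞ q ⟧ = ⟦ p ⟧ ⊕ ⟦ q ⟧

_∙_ : Poly → Series → Series
(mono a i j ∙ f) n k = a * shift i j f n k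
((p ⊞ q) ∙ f) n k = (p ∙ f) n k + (q ∙ f) n k

⊛≈∙ : ∀ f p → f ⊛ ⟦ p ⟧ ≈ p ∙ f
⊛≈∙ f (mono a i j) n k = ⊛-monomial f a i j n k
⊛≈∙ f (p ⊞ q) n k = trans (⊛-distribˡ-⊕ f ⟦ p ⟧ ⟦ q ⟧ n k)
  (cong₂ _+_ (⊛≈∙ f p n k) (⊛≈∙ f q n k))

⟦_⟧≈∙𝟙 : ∀ p → ⟦ p ⟧ ≈ p ∙ 𝟙
⟦ mono a i j ⟧≈∙𝟙 n k = monomial≡shift a i j n k
⟦ p ⊞ q ⟧≈∙𝟙 n k = cong₂ _+_ (⟦ p ⟧≈∙𝟙 n k) (⟦ q ⟧≈∙𝟙 n k)

num den : Poly
num = mono (+ 1) 0 0 ⊞ mono (+ 1) 1 1 ⊞ mono (+ 1) 2 0 ⊞ mono (+ 1) 2 1 ⊞ mono (+ 1) 3 0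
  ⊞ mono (+ 3) 3 1 ⊞ mono (+ 1) 3 2 ⊞ mono (+ 2) 4 1 ⊞ mono (+ 2) 4 2 ⊞ mono (+ 1) 5 2
den = mono (+ 1) 0 0 ⊞ mono (- + 2) 1 0 ⊞ mono (+ 1) 2 0 ⊞ mono (- + 1) 3 0 ⊞ mono (- + 1) 4 0
  ⊞ mono (- + 2) 4 1 ⊞ mono (- + 2) 5 1 ⊞ mono (- + 1) 5 2 ⊞ mono (- + 1) 6 2

-- `A`, `C`, `E`, `I` hold the multiples by x^i y^j of the series W, L, E, 1; so `C` belongs to
-- `leaving`, not to `centre`. With z = x + x²y, eliminating L and E from (1 - x)W = 1 + xy + zL, (1
-- - x)L = 1 + xy + x²y + (1 + x)zE and E = 1 + xW leaves W with the factor (1 - x)² - x(1 + x)z²,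
-- which is the denominator.
elimination : ∀ (A C E I : ℕ → ℕ → ℤ) →
  (∀ i j → A i j ≡ I i j + A (1 ℕ.+ i) j +
    + 1 * (I (1 ℕ.+ i) (1 ℕ.+ j) + C (1 ℕ.+ i) j + C (2 ℕ.+ i) (1 ℕ.+ j))) →
  (∀ i j → C i j ≡ C (1 ℕ.+ i) j +
    (I i j + I (1 ℕ.+ i) (1 ℕ.+ j) + I (2 ℕ.+ i) (1 ℕ.+ j) +
     E (1 ℕ.+ i) j + E (2 ℕ.+ i) (1 ℕ.+ j) + E (2 ℕ.+ i) j + E (3 ℕ.+ i) (1 ℕ.+ j))) →
  (∀ i j → E i j ≡ I i j + A (1 ℕ.+ i) j) →
  + 1 * A 0 0 + - + 2 * A 1 0 + + 1 * A 2 0 + - + 1 * A 3 0 + - + 1 * A 4 0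
    + - + 2 * A 4 1 + - + 2 * A 5 1 + - + 1 * A 5 2 + - + 1 * A 6 2 ≡
  + 1 * I 0 0 + + 1 * I 1 1 + + 1 * I 2 0 + + 1 * I 2 1 + + 1 * I 3 0
    + + 3 * I 3 1 + + 1 * I 3 2 + + 2 * I 4 1 + + 2 * I 4 2 + + 1 * I 5 2
elimination A C E I eqA eqC eqE = linear
  (A 2 0) (A 3 0) (A 4 0) (A 4 1) (A 5 1) (A 5 2) (A 6 2) (C 2 0) (C 3 1)
  (I 0 0) (I 1 0) (I 1 1) (I 2 0) (I 2 1) (I 3 0) (I 3 1) (I 3 2) (I 4 1) (I 4 2) (I 5 2)
  -- The multiples are those by the monomials of 1 - x for W, of z for L and of (1 + x)z² for E.
  (eqA 0 0) (eqA 1 0) (eqC 1 0) (eqC 2 1)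
  (eqE 2 0) (eqE 3 0) (eqE 3 1) (eqE 4 1) (eqE 4 2) (eqE 5 2)
  where
  -- Each hypothesis has a variable of its own on the left, so matching on `refl` substitutes it and
  -- a ring identity remains.
  linear : ∀ {a00 a10 c10 c21 e20 e30 e31 e41 e42 e52 : ℤ}
    a20 a30 a40 a41 a51 a52 a62 c20 c31 i00 i10 i11 i20 i21 i30 i31 i32 i41 i42 i52 →
    a00 ≡ i00 + a10 + + 1 * (i11 + c10 + c21) →
    a10 ≡ i10 + a20 + + 1 * (i21 + c20 + c31) →
    c10 ≡ c20 + (i10 + i21 + i31 + e20 + e31 + e30 + e41) →
    c21 ≡ c31 + (i21 + i32 + i42 + e31 + e42 + e41 + e52) →
    e20 ≡ i20 + a30 → e30 ≡ i30 + a40 → e31 ≡ i31 + a41 →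
    e41 ≡ i41 + a51 → e42 ≡ i42 + a52 → e52 ≡ i52 + a62 →
    + 1 * a00 + - + 2 * a10 + + 1 * a20 + - + 1 * a30 + - + 1 * a40
      + - + 2 * a41 + - + 2 * a51 + - + 1 * a52 + - + 1 * a62 ≡
    + 1 * i00 + + 1 * i11 + + 1 * i20 + + 1 * i21 + + 1 * i30
      + + 3 * i31 + + 1 * i32 + + 2 * i41 + + 2 * i42 + + 1 * i52
  linear a20 a30 a40 a41 a51 a52 a62 c20 c31 i00 i10 i11 i20 i21 i30 i31 i32 i41 i42 i52
    refl refl refl refl refl refl refl refl refl refl =
    solve (
      a20 List.∷ a30 List.∷ a40 List.∷ a41 List.∷ a51 List.∷ a52 List.∷ a62 List.∷
      c20 List.∷ c31 List.∷ i00 List.∷ i10 List.∷ i11 List.∷ i20 List.∷ i21 List.∷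
      i30 List.∷ i31 List.∷ i32 List.∷ i41 List.∷ i42 List.∷ i52 List.∷ List.[])

module _ (n k : ℕ) where
  private
    A B C E I : ℕ → ℕ → ℤ
    A i j = shift i j (F wall) n k
    B i j = shift i j (F centre) n k
    C i j = shift i j (F leaving) n k
    E i j = shift i j (F landing) n k
    I i j = shift i j 𝟙 n k

  wall-recurrence : ∀ i j → A i j ≡ I i j + A (1 ℕ.+ i) j +
    + 1 * (I (1 ℕ.+ i) (1 ℕ.+ j) + C (1 ℕ.+ i) j + C (2 ℕ.+ i) (1 ℕ.+ j))
  wall-recurrence i j = count-equation wall i j n k

  landing-recurrence : ∀ i j → E i j ≡ I i j + A (1 ℕ.+ i) j
  -- `landing` has no exits, so the vertical summand is zero.
  landing-recurrence i j = trans (count-equation landing i j n k) (+-identityʳ _)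

  -- (1 - x) C with the equations of `leaving` and `centre` substituted.
  leaving-recurrence : ∀ i j → C i j ≡ C (1 ℕ.+ i) j +
    (I i j + I (1 ℕ.+ i) (1 ℕ.+ j) + I (2 ℕ.+ i) (1 ℕ.+ j) +
     E (1 ℕ.+ i) j + E (2 ℕ.+ i) (1 ℕ.+ j) + E (2 ℕ.+ i) j + E (3 ℕ.+ i) (1 ℕ.+ j))
  leaving-recurrence i j
    rewrite count-equation leaving i j n k
          | count-equation leaving (1 ℕ.+ i) j n k
          | count-equation centre (1 ℕ.+ i) j n k
    = lemma (I i j) (I (1 ℕ.+ i) j) (I (1 ℕ.+ i) (1 ℕ.+ j)) (I (2 ℕ.+ i) (1 ℕ.+ j))
        (B (2 ℕ.+ i) j) (E (1 ℕ.+ i) j) (E (2 ℕ.+ i) (1 ℕ.+ j)) (E (2 ℕ.+ i) j)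
        (E (3 ℕ.+ i) (1 ℕ.+ j))
    where
    lemma : ∀ i0 i1 j1 j2 b e1 e2 f1 f2 →
      i0 + (i1 + b + + 2 * (j2 + f1 + f2)) + + 1 * (j1 + e1 + e2) ≡
      (i1 + b + + 1 * (j2 + f1 + f2)) + (i0 + j1 + j2 + e1 + e2 + f1 + f2)
    lemma = solve-∀


  wall-identity : (den ∙ F wall) n k ≡ (num ∙ 𝟙) n k
  wall-identity = elimination A C E I wall-recurrence leaving-recurrence landing-recurrence

generatingFunction-count-wall : F wall ≈ numerator / denominator
generatingFunction-count-wall n k = trans (⊛≈∙ (F wall) den n k)
  (trans (wall-identity n k) (sym (⟦ num ⟧≈∙𝟙 n k)))

theorem1p4 : Σ[ c ∈ (ℕ → ℕ → ℕ) ]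
    ((∀ n k → HasCardinality (cubes n k) (c n k)) ×
    (generatingFunction c ≈ numerator / denominator))
theorem1p4 = count wall , count-cubes , generatingFunction-count-wall
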